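{- Let $a,b\ge1$ and $n\ge 0$ be integers, and let $e^{a,b}_n$ denote the number of edges of the Horadam cube $\Pi^{a,b}_n$. Then $$e^{a,b}_n=\sum_{k=0}^{n-1}s^{a,b}_k\left(s^{a,b}_{n-k}-s^{a,b}_{n-1-k}\right).$$
   Context: For integers $a,b\ge1$ and $n\ge 0$, $\mathcal S^{a,b}_n$ is the set of all strings of length $n$ over the alphabet $\{0,1,\dots,a+b-1\}$ in which every letter from $\{a,\dots,a+b-1\}$ appears only immediately after a letter $0$; $\mathcal S^{a,b}_0$ contains only the empty string. The Horadam cube $\Pi^{a,b}_n$ is the simple graph with vertex set $\mathcal S^{a,b}_n$ in which $x_1\cdots x_n$ and $y_1\cdots y_n$ are adjacent if and only if $\sum_{i=1}^n|x_i-y_i|=1$. $s^{a,b}_n=|\mathcal S^{a,b}_n|$ is its number of vertices; equivalently $s^{a,b}_0=1$, $s^{a,b}_1=a$ and $s^{a,b}_n=as^{a,b}_{n-1}+bs^{a,b}_{n-2}$ for $n\ge2$. -}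

module Defs where

open import Data.Fin.Base using (Fin; toℕ)
open import Data.Fin.Properties using (all?; any?)
open import Data.Integer.Properties using (+-0-commutativeMonoid)
open import Data.List.Base
  using (List; []; _∷_; _++_; [_]; map; filter; length; allFin; cartesianProductWith)
open import Data.List.Membership.Propositional using (_∈_)
open import Data.List.Membership.Propositional.Properties
  using (∈-allFin; ∈-cartesianProductWith⁺; ∈-filter⁺; ∈-filter⁻; ∈-map⁺; ∈-map⁻; ∈-++⁺ˡ; ∈-++⁺ʳ; ∈-++⁻)
open import Data.List.Relation.Unary.All as All using (All; []; _∷_)
open import Data.List.Relation.Unary.AllPairs using (AllPairs; []; _∷_)
import Data.List.Relation.Unary.AllPairs.Properties as AllPairs
open import Data.List.Relation.Unary.Any using (here; there)
open import Data.List.Relation.Unary.Unique.Propositional using (Unique)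
import Data.List.Relation.Unary.Unique.Propositional.Properties as Unique
open import Data.Nat.Base using (ℕ; zero; suc; _+_; _≤_; ∣_-_∣)
open import Data.Nat.Properties using (_≟_; _≤?_; ∣-∣-comm; ∣n-n∣≡0)
open import Data.Product.Base using (_×_; _,_; ∃-syntax; proj₁; proj₂; swap)
open import Data.Sum.Base as Sum using (_⊎_; inj₁; inj₂)
open import Data.Vec.Base using (Vec; []; _∷_; lookup; zipWith; sum)
open import Data.Vec.Properties using (∷-injective; zipWith-comm)
open import Function.Base using (_∘_)
open import Relation.Binary.Core using (Rel)
open import Relation.Binary.Definitions using (Symmetric; Irreflexive)
import Relation.Binary.Definitions as B
open import Relation.Binary.PropositionalEquality
  using (_≡_; _≢_; refl; sym; trans; cong; cong₂)
open import Relation.Nullary.Decidable using (_×-dec_; _→-dec_)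
open import Relation.Nullary.Negation using (contradiction)
open import Relation.Unary using (Decidable)
open import Level using (0ℓ)

open import Algebra.Properties.CommutativeMonoid.Sum +-0-commutativeMonoid public
  using (sum-syntax)

------------------------------------------------------------------------
-- Finite simple graphs

-- (x , y) is listed once for each pair of positions i < j of the list holding
-- x and y; for a list without repetitions these are its two-element subsets.
pairs : {A : Set} → List A → List (A × A)
pairs []       = []
pairs (x ∷ xs) = map (x ,_) xs ++ pairs xs

-- The vertex set is the finite subset of V listed by `vertices`.
record FiniteSimpleGraph : Set₁ where
  field
    V        : Set
    vertices : List V
    unique   : Unique vertices
    Adj      : Rel V 0ℓ
    Adj?     : B.Decidable Adj
    symm     : Symmetric Adj
    irrefl   : Irreflexive _≡_ Adj

  edges : List (V × V)
  edges = filter (λ e → Adj? (proj₁ e) (proj₂ e)) (pairs vertices)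

  order : ℕ
  order = length vertices

  size : ℕ
  size = length edges

open FiniteSimpleGraph public using (order; size)

------------------------------------------------------------------------
-- Horadam cubes

Word : ℕ → ℕ → ℕ → Set
Word a b n = Vec (Fin (a + b)) n

Admissible : ∀ a b n → Word a b n → Set
Admissible a b n w = ∀ (i : Fin n) → a ≤ toℕ (lookup w i) →
  ∃[ j ] (suc (toℕ j) ≡ toℕ i × toℕ (lookup w j) ≡ 0)

admissible? : ∀ a b n → Decidable (Admissible a b n)
admissible? a b n w = all? λ i → (a ≤? toℕ (lookup w i)) →-dec
  any? λ j → (suc (toℕ j) ≟ toℕ i) ×-dec (toℕ (lookup w j) ≟ 0)

words : ∀ a b n → List (Word a b n)
words a b zero    = [ [] ]
words a b (suc n) = cartesianProductWith _∷_ (allFin (a + b)) (words a b n)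

𝒮 : ∀ a b n → List (Word a b n)
𝒮 a b n = filter (admissible? a b n) (words a b n)

s : ℕ → ℕ → ℕ → ℕ
s a b n = length (𝒮 a b n)

dist : ∀ {m n} → Vec (Fin m) n → Vec (Fin m) n → ℕ
dist x y = sum (zipWith (λ p q → ∣ toℕ p - toℕ q ∣) x y)

words-unique : ∀ a b n → Unique (words a b n)
words-unique a b zero    = [] ∷ []
words-unique a b (suc n) =
  Unique.cartesianProductWith⁺ _∷_ ∷-injective (Unique.allFin⁺ (a + b)) (words-unique a b n)

dist-comm : ∀ {m n} (x y : Vec (Fin m) n) → dist x y ≡ dist y x
dist-comm x y = cong sum (zipWith-comm (λ p q → ∣-∣-comm (toℕ p) (toℕ q)) x y)

dist-self : ∀ {m n} (x : Vec (Fin m) n) → dist x x ≡ 0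
dist-self []      = refl
dist-self (p ∷ x) = cong₂ _+_ (∣n-n∣≡0 (toℕ p)) (dist-self x)

Π : ℕ → ℕ → ℕ → FiniteSimpleGraph
Π a b n = record
  { V        = Word a b n
  ; vertices = 𝒮 a b n
  ; unique   = Unique.filter⁺ (admissible? a b n) (words-unique a b n)
  ; Adj      = λ x y → dist x y ≡ 1
  ; Adj?     = λ x y → dist x y ≟ 1
  ; symm     = λ {x} {y} d → trans (dist-comm y x) d
  ; irrefl   = λ { {x} refl d → contradiction (trans (sym (dist-self x)) d) λ () }
  }

------------------------------------------------------------------------
-- The lists above enumerate exactly what they should.

∈-words : ∀ a b n (w : Word a b n) → w ∈ words a b n
∈-words a b zero    []      = here refl
∈-words a b (suc n) (p ∷ w) = ∈-cartesianProductWith⁺ _∷_ (∈-allFin p) (∈-words a b n w)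

∈-𝒮⁺ : ∀ a b n {w} → Admissible a b n w → w ∈ 𝒮 a b n
∈-𝒮⁺ a b n {w} = ∈-filter⁺ (admissible? a b n) (∈-words a b n w)

∈-𝒮⁻ : ∀ a b n {w} → w ∈ 𝒮 a b n → Admissible a b n w
∈-𝒮⁻ a b n = proj₂ ∘ ∈-filter⁻ (admissible? a b n) {xs = words a b n}

module _ {A : Set} where

  ∈-pairs⁺ : ∀ {xs : List A} {x y} → x ∈ xs → y ∈ xs → x ≢ y →
             (x , y) ∈ pairs xs ⊎ (y , x) ∈ pairs xs
  ∈-pairs⁺ (here refl) (here refl) x≢y = contradiction refl x≢y
  ∈-pairs⁺ (here refl) (there y∈)  x≢y = inj₁ (∈-++⁺ˡ (∈-map⁺ _ y∈))
  ∈-pairs⁺ (there x∈)  (here refl) x≢y = inj₂ (∈-++⁺ˡ (∈-map⁺ _ x∈))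
  ∈-pairs⁺ {z ∷ xs} (there x∈) (there y∈) x≢y =
    Sum.map (∈-++⁺ʳ (map (z ,_) xs)) (∈-++⁺ʳ (map (z ,_) xs)) (∈-pairs⁺ x∈ y∈ x≢y)

  ∈-pairs⁻ : ∀ (xs : List A) {x y} → (x , y) ∈ pairs xs → x ∈ xs × y ∈ xs
  ∈-pairs⁻ (z ∷ xs) xy∈ with ∈-++⁻ (map (z ,_) xs) xy∈
  ... | inj₁ p with _ , y∈ , refl ← ∈-map⁻ (z ,_) p = here refl , there y∈
  ... | inj₂ p with x∈ , y∈ ← ∈-pairs⁻ xs p         = there x∈ , there y∈

  pairs-distinct : ∀ {xs : List A} → Unique xs →
                   AllPairs (λ p q → p ≢ q × p ≢ swap q) (pairs xs)
  pairs-distinct [] = []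
  pairs-distinct {x ∷ xs} (x∉ ∷ u) = AllPairs.++⁺ first (pairs-distinct u) rest
    where
    x≢ : ∀ {y} → y ∈ xs → x ≢ y
    x≢ = All.lookup x∉

    row : ∀ {ys} → All (x ≢_) ys → Unique ys →
          AllPairs (λ y z → (x , y) ≢ (x , z) × (x , y) ≢ (z , x)) ys
    row []        []        = []
    row (_ ∷ ps) (y∉ ∷ us) = All.zipWith
      (λ { (x≢z , y≢z) → (λ { refl → y≢z refl }) , (λ { refl → x≢z refl }) }) (ps , y∉)
      ∷ row ps us

    first : AllPairs (λ p q → p ≢ q × p ≢ swap q) (map (x ,_) xs)
    first = AllPairs.map⁺ (row x∉ u)

    rest : All (λ p → All (λ q → p ≢ q × p ≢ swap q) (pairs xs)) (map (x ,_) xs)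
    rest = All.tabulate λ p∈ → All.tabulate λ {q} q∈ → apart p∈ q∈
      where
      apart : ∀ {p q} → p ∈ map (x ,_) xs → q ∈ pairs xs → p ≢ q × p ≢ swap q
      apart p∈ q∈ with _ , _ , refl ← ∈-map⁻ (x ,_) p∈ | y∈ , z∈ ← ∈-pairs⁻ xs q∈ =
        (λ { refl → x≢ y∈ refl }) , (λ { refl → x≢ z∈ refl })

module _ (G : FiniteSimpleGraph) where
  open FiniteSimpleGraph G

  ∈-edges⁺ : ∀ {x y} → x ∈ vertices → y ∈ vertices → Adj x y →
             (x , y) ∈ edges ⊎ (y , x) ∈ edges
  ∈-edges⁺ x∈ y∈ xy = Sum.map (λ p → ∈-filter⁺ _ p xy) (λ p → ∈-filter⁺ _ p (symm xy))
    (∈-pairs⁺ x∈ y∈ λ x≡y → irrefl x≡y xy)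

  ∈-edges⁻ : ∀ {x y} → (x , y) ∈ edges → x ∈ vertices × y ∈ vertices × Adj x y
  ∈-edges⁻ e with p , xy ← ∈-filter⁻ _ {xs = pairs vertices} e
             with x∈ , y∈ ← ∈-pairs⁻ vertices p = x∈ , y∈ , xy

  edges-distinct : AllPairs (λ p q → p ≢ q × p ≢ swap q) edges
  edges-distinct = AllPairs.filter⁺ _ (pairs-distinct unique)

{-# OPTIONS --safe #-}
-- Let A n = s n and e n count the admissible words of length n and their edges,
-- and let B n and e' n do the same for the words admissible after a letter 0.
-- Splitting by first letters (equal, or consecutive with a common tail),
--   A (n+1) = B n + (a-1) A n      e  (n+1) = e' n + (a-1)   (e n + A n)
--   B (n+1) = B n + (a+b-1) A n    e' (n+1) = e' n + (a+b-1) (e n + A n),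
-- and eliminating B and e' gives
--   e (n+2) = a e (n+1) + b (e n + s n) + (a-1) s (n+1),
-- a recurrence the convolution satisfies as well.  Edges are counted as ordered
-- pairs, so that sums over all pairs of words factor letter by letter.
module Submission where

open import Defs
open import Data.Bool.Base using (Bool; true; false; _∧_; _∨_; T)
open import Data.Bool.Properties using (T-∧; T-∨)
open import Data.Fin.Base using (Fin; toℕ) renaming (zero to fzero; suc to fsuc)
open import Data.Integer.Base using (ℤ; +_; _*_; _-_) renaming (_+_ to _+ℤ_)
import Data.Integer.Properties as ℤ
open import Data.Integer.Tactic.RingSolver using () renaming (solve-∀ to solve-∀ℤ)
open import Data.List.Base
  using (List; []; _∷_; _++_; map; filter; length; allFin; cartesianProductWith)
open import Data.List.Properties using (map-++; map-∘; map-cong; map-tabulate)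
open import Data.Nat.ListAction using () renaming (sum to sumᴸ)
open import Data.Nat.ListAction.Properties using (sum-++)
open import Data.Nat.Base using (ℕ; zero; suc; _≤_; _∸_; _≡ᵇ_; _<ᵇ_; ∣_-_∣)
  renaming (_+_ to _+ℕ_; _*_ to _*ℕ_)
import Data.Nat.Properties as ℕ
open import Data.Nat.Tactic.RingSolver using (solve-∀)
open import Data.Product.Base using (_×_; _,_; ∃-syntax; proj₁; proj₂; uncurry)
open import Data.Sum.Base using (_⊎_; inj₁; inj₂)
open import Data.Vec.Base using ([]; _∷_; lookup)
open import Function.Base using (_∘_)
open import Function.Bundles using (_⇔_; mk⇔; module Equivalence)
open import Relation.Binary.PropositionalEquality
  using (_≡_; refl; sym; trans; cong; cong₂; module ≡-Reasoning)
open import Relation.Nullary.Decidable.Core using (does; T?)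
open import Relation.Nullary.Decidable using (does-⇔)
open import Relation.Nullary.Negation using (contradiction)
open import Relation.Unary using (Decidable)

open ≡-Reasoning

-- Sums over finite lists.

private
  variable
    A B C : Set

ind : Bool → ℕ
ind true  = 1
ind false = 0

ind-∧ : ∀ x y → ind (x ∧ y) ≡ ind x *ℕ ind y
ind-∧ true  y = sym (ℕ.+-identityʳ (ind y))
ind-∧ false y = refl

ind-idem : ∀ x → ind x *ℕ ind x ≡ ind x
ind-idem true  = refl
ind-idem false = refl

total : List A → (A → ℕ) → ℕ
total xs f = sumᴸ (map f xs)

total-cong : ∀ (xs : List A) {f g : A → ℕ} → (∀ x → f x ≡ g x) → total xs f ≡ total xs g
total-cong xs f≗g = cong sumᴸ (map-cong f≗g xs)

total-++ : ∀ (xs ys : List A) f → total (xs ++ ys) f ≡ total xs f +ℕ total ys f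
total-++ xs ys f = trans (cong sumᴸ (map-++ f xs ys)) (sum-++ (map f xs) (map f ys))

total-map : ∀ (h : B → A) xs f → total (map h xs) f ≡ total xs (f ∘ h)
total-map h xs f = cong sumᴸ (sym (map-∘ xs))

total-const0 : ∀ (xs : List A) → total xs (λ _ → 0) ≡ 0
total-const0 []       = refl
total-const0 (_ ∷ xs) = total-const0 xs

total-+ : ∀ (xs : List A) f g → total xs (λ x → f x +ℕ g x) ≡ total xs f +ℕ total xs g
total-+ []       f g = refl
total-+ (x ∷ xs) f g rewrite total-+ xs f g = lemma (f x) (g x) (total xs f) (total xs g)
  where
  lemma : ∀ u v p q → (u +ℕ v) +ℕ (p +ℕ q) ≡ (u +ℕ p) +ℕ (v +ℕ q)
  lemma = solve-∀

total-*ˡ : ∀ (xs : List A) k f → total xs (λ x → k *ℕ f x) ≡ k *ℕ total xs f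
total-*ˡ []       k f = sym (ℕ.*-zeroʳ k)
total-*ˡ (x ∷ xs) k f =
  trans (cong (k *ℕ f x +ℕ_) (total-*ˡ xs k f)) (sym (ℕ.*-distribˡ-+ k (f x) (total xs f)))

total-comm : ∀ (xs : List A) (ys : List B) (f : A → B → ℕ) →
  total xs (λ x → total ys (f x)) ≡ total ys (λ y → total xs λ x → f x y)
total-comm []       ys f = sym (total-const0 ys)
total-comm (x ∷ xs) ys f = trans (cong (total ys (f x) +ℕ_) (total-comm xs ys f))
  (sym (total-+ ys (f x) (λ y → total xs λ x → f x y)))

total-filter : ∀ {P : A → Set} (P? : Decidable P) xs f →
  total (filter P? xs) f ≡ total xs (λ x → ind (does (P? x)) *ℕ f x)
total-filter P? []       f = refl
total-filter P? (x ∷ xs) f with does (P? x)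
... | true  = cong₂ _+ℕ_ (sym (ℕ.+-identityʳ (f x))) (total-filter P? xs f)
... | false = total-filter P? xs f

length-filter : ∀ {P : A → Set} (P? : Decidable P) xs →
  length (filter P? xs) ≡ total xs (λ x → ind (does (P? x)))
length-filter P? []       = refl
length-filter P? (x ∷ xs) with does (P? x)
... | true  = cong suc (length-filter P? xs)
... | false = length-filter P? xs

-- Removing the head `x` takes a row and a column out of the double sum. They are equal by symmetry
-- and together give twice the pairs that begin with `x`; the corner `f x x` is zero.
total-pairs : ∀ (f : A → A → ℕ) → (∀ x y → f x y ≡ f y x) → (∀ x → f x x ≡ 0) →
  ∀ xs → 2 *ℕ total (pairs xs) (uncurry f) ≡ total xs (λ x → total xs (f x))
total-pairs f f-sym f-irr []       = refl
total-pairs f f-sym f-irr (x ∷ xs) = begin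
  2 *ℕ total (map (x ,_) xs ++ pairs xs) (uncurry f)
    ≡⟨ cong (2 *ℕ_) (total-++ (map (x ,_) xs) (pairs xs) (uncurry f)) ⟩
  2 *ℕ (total (map (x ,_) xs) (uncurry f) +ℕ total (pairs xs) (uncurry f))
    ≡⟨ cong (λ u → 2 *ℕ (u +ℕ total (pairs xs) (uncurry f))) (total-map (x ,_) xs (uncurry f)) ⟩
  2 *ℕ (row +ℕ total (pairs xs) (uncurry f))
    ≡⟨ arith row _ ⟩
  row +ℕ (row +ℕ 2 *ℕ total (pairs xs) (uncurry f))
    ≡⟨ cong₂ (λ u v → row +ℕ (u +ℕ v)) (total-cong xs (f-sym x)) (total-pairs f f-sym f-irr xs) ⟩
  row +ℕ (total xs (λ z → f z x) +ℕ total xs (λ z → total xs (f z)))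
    ≡⟨ cong (row +ℕ_) (total-+ xs (λ z → f z x) (λ z → total xs (f z))) ⟨
  row +ℕ total xs (λ z → f z x +ℕ total xs (f z))
    ≡⟨ cong (λ u → u +ℕ row +ℕ total xs (λ z → f z x +ℕ total xs (f z))) (f-irr x) ⟨
  f x x +ℕ row +ℕ total xs (λ z → f z x +ℕ total xs (f z)) ∎
  where
  row = total xs (f x)
  arith : ∀ u v → 2 *ℕ (u +ℕ v) ≡ u +ℕ (u +ℕ 2 *ℕ v)
  arith = solve-∀

total-cartesianProductWith : ∀ (h : A → B → C) xs ys f →
  total (cartesianProductWith h xs ys) f ≡ total xs (λ x → total ys (f ∘ h x))
total-cartesianProductWith h []       ys f = refl
total-cartesianProductWith h (x ∷ xs) ys f =
  trans (total-++ (map (h x) ys) _ f)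
        (cong₂ _+ℕ_ (total-map (h x) ys f) (total-cartesianProductWith h xs ys f))

total-product : ∀ (xs : List A) (ys : List B) (f : A → ℕ) (g : A → B → ℕ) →
  total xs (λ x → total ys λ y → f x *ℕ g x y) ≡ total xs (λ x → f x *ℕ total ys (g x))
total-product xs ys f g = total-cong xs λ x → total-*ˡ ys (f x) (g x)

-- Sums over letters.

total-allFin : ∀ {m} (f : Fin (suc m) → ℕ) →
  total (allFin (suc m)) f ≡ f fzero +ℕ total (allFin m) (f ∘ fsuc)
total-allFin {m} f = cong (λ l → f fzero +ℕ sumᴸ l)
  (trans (map-tabulate fsuc f) (sym (map-tabulate (λ i → i) (f ∘ fsuc))))

-- The summand lives on ℕ rather than on `Fin m`, so the same function can be summed over ranges of
-- different size and shifted by `suc`.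
below : ℕ → (ℕ → ℕ) → ℕ
below m g = total (allFin m) (g ∘ toℕ)

below-suc : ∀ m g → below (suc m) g ≡ g 0 +ℕ below m (g ∘ suc)
below-suc m g = total-allFin {m} (g ∘ toℕ)

below-const : ∀ m k → below m (λ _ → k) ≡ m *ℕ k
below-const zero    k = refl
below-const (suc m) k = trans (below-suc m (λ _ → k)) (cong (k +ℕ_) (below-const m k))

-- Serves the first letter of a word with no 0 before it: of the `a + b` letters only those smaller
-- than `a` survive.
below-restrict : ∀ m k g → below (m +ℕ k) (λ p → ind (p <ᵇ m) *ℕ g p) ≡ below m g
below-restrict zero    k g = total-const0 (allFin k)
below-restrict (suc m) k g = begin
  below (suc m +ℕ k) (λ p → ind (p <ᵇ suc m) *ℕ g p)        ≡⟨ below-suc (m +ℕ k) (λ p → ind (p <ᵇ suc m) *ℕ g p) ⟩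
  1 *ℕ g 0 +ℕ below (m +ℕ k) (λ p → ind (p <ᵇ m) *ℕ g (suc p))
    ≡⟨ cong₂ _+ℕ_ (ℕ.*-identityˡ (g 0)) (below-restrict m k (g ∘ suc)) ⟩
  g 0 +ℕ below m (g ∘ suc)                                  ≡⟨ below-suc m g ⟨
  below (suc m) g ∎

-- Kronecker delta. It is built on `≡ᵇ`, to which `does` of the equality test in `Adj?` reduces, so
-- `δ 1 (dist x y)` is the adjacency indicator by computation.
δ : ℕ → ℕ → ℕ
δ k d = ind (d ≡ᵇ k)

δ-0-+ : ∀ u v → δ 0 (u +ℕ v) ≡ δ 0 u *ℕ δ 0 v
δ-0-+ zero    v = sym (ℕ.+-identityʳ (δ 0 v))
δ-0-+ (suc u) v = refl

-- Two naturals add up to 1 only as 0 + 1 or 1 + 0. For a first letter and a tail this is the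
-- dichotomy of edges: the tails differ or the first letters differ, never both.
δ-1-+ : ∀ u v → δ 1 (u +ℕ v) ≡ δ 0 u *ℕ δ 1 v +ℕ δ 1 u *ℕ δ 0 v
δ-1-+ zero          v = arith (δ 1 v)
  where
  arith : ∀ x → x ≡ 1 *ℕ x +ℕ 0
  arith = solve-∀
δ-1-+ (suc zero)    v = sym (ℕ.+-identityʳ (δ 0 v))
δ-1-+ (suc (suc u)) v = refl

below-δ : ∀ m → below (suc m) (δ 0) ≡ 1
below-δ m = trans (below-suc m (δ 0)) (cong suc (total-const0 (allFin m)))

-- The path on `suc m` vertices has `m` edges, each seen in both orders. The induction removes the
-- end vertex 0.
below-adjacent : ∀ m → below (suc m) (λ p → below (suc m) λ q → δ 1 ∣ p - q ∣) ≡ 2 *ℕ m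
below-adjacent zero    = refl
below-adjacent (suc m) = begin
  below (2 +ℕ m) (λ p → below (2 +ℕ m) λ q → δ 1 ∣ p - q ∣)
    ≡⟨ below-suc (suc m) (λ p → below (2 +ℕ m) λ q → δ 1 ∣ p - q ∣) ⟩
  below (2 +ℕ m) (δ 1) +ℕ below (suc m) (λ p → below (2 +ℕ m) λ q → δ 1 ∣ suc p - q ∣)
    -- The only neighbour of 0 is 1: the row of 0 contributes 1, and its column becomes `δ 0 p`
    -- after the shift, which contributes another 1.
    ≡⟨ cong₂ _+ℕ_ (trans (below-suc (suc m) (δ 1)) (below-δ m))
         (total-cong (allFin (suc m)) λ p → below-suc (suc m) λ q → δ 1 ∣ suc (toℕ p) - q ∣) ⟩
  1 +ℕ below (suc m) (λ p → δ 0 p +ℕ below (suc m) λ q → δ 1 ∣ p - q ∣)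
    ≡⟨ cong suc (total-+ (allFin (suc m)) (δ 0 ∘ toℕ) _) ⟩
  1 +ℕ (below (suc m) (δ 0) +ℕ below (suc m) (λ p → below (suc m) λ q → δ 1 ∣ p - q ∣))
    ≡⟨ cong suc (cong₂ _+ℕ_ (below-δ m) (below-adjacent m)) ⟩
  1 +ℕ (1 +ℕ 2 *ℕ m)
    ≡⟨ ℕ.*-suc 2 m ⟨
  2 *ℕ suc m ∎

total-δ-letter : ∀ {m} (p : Fin m) (g : Fin m → ℕ) →
  total (allFin m) (λ q → δ 0 ∣ toℕ p - toℕ q ∣ *ℕ g q) ≡ g p
total-δ-letter {suc m} fzero g = begin
  total (allFin (suc m)) (λ q → δ 0 (toℕ q) *ℕ g q) ≡⟨ total-allFin (λ q → δ 0 (toℕ q) *ℕ g q) ⟩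
  1 *ℕ g fzero +ℕ total (allFin m) (λ _ → 0)
    ≡⟨ cong₂ _+ℕ_ (ℕ.*-identityˡ (g fzero)) (total-const0 (allFin m)) ⟩
  g fzero +ℕ 0                                       ≡⟨ ℕ.+-identityʳ (g fzero) ⟩
  g fzero ∎
total-δ-letter {suc m} (fsuc p) g =
  trans (total-allFin (λ q → δ 0 ∣ suc (toℕ p) - toℕ q ∣ *ℕ g q)) (total-δ-letter p (g ∘ fsuc))

-- Sums over words.

module Count (a′ b : ℕ) where

  -- With this form the coefficient a - 1 is simply `a′`, and no subtraction of naturals enters the
  -- counting.
  a = suc a′

  W : ℕ → Set
  W = Word a b

  ws : ∀ n → List (W n)
  ws = words a b

  letters : List (Fin (a +ℕ b))
  letters = allFin (a +ℕ b)

  total-words : ∀ n (f : W (suc n) → ℕ) →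
    total (ws (suc n)) f ≡ total letters (λ p → total (ws n) λ w → f (p ∷ w))
  total-words n f = total-cartesianProductWith _∷_ letters (ws n) f

  -- Distance zero forces equality, so the sum keeps only the term `y = x`. The delta factors over
  -- first letter and tail, which reduces the claim to one letter at a time.
  total-δ-word : ∀ {n} (x : W n) (g : W n → ℕ) → total (ws n) (λ y → δ 0 (dist x y) *ℕ g y) ≡ g x
  total-δ-word []      g = arith (g [])
    where
    arith : ∀ u → 1 *ℕ u +ℕ 0 ≡ u
    arith = solve-∀
  total-δ-word {suc n} (p ∷ x) g = begin
    total (ws (suc n)) (λ y → δ 0 (dist (p ∷ x) y) *ℕ g y)
      ≡⟨ total-words n _ ⟩
    total letters (λ q → total (ws n) λ y → δ 0 (∣ toℕ p - toℕ q ∣ +ℕ dist x y) *ℕ g (q ∷ y))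
      ≡⟨ total-cong letters (λ q → total-cong (ws n) λ y → factor q y) ⟩
    total letters (λ q → total (ws n) λ y → δ 0 ∣ toℕ p - toℕ q ∣ *ℕ (δ 0 (dist x y) *ℕ g (q ∷ y)))
      ≡⟨ total-product letters (ws n) (λ q → δ 0 ∣ toℕ p - toℕ q ∣) (λ q y → δ 0 (dist x y) *ℕ g (q ∷ y)) ⟩
    total letters (λ q → δ 0 ∣ toℕ p - toℕ q ∣ *ℕ total (ws n) λ y → δ 0 (dist x y) *ℕ g (q ∷ y))
      ≡⟨ total-δ-letter p _ ⟩
    total (ws n) (λ y → δ 0 (dist x y) *ℕ g (p ∷ y))
      ≡⟨ total-δ-word x (g ∘ (p ∷_)) ⟩
    g (p ∷ x) ∎
    where
    factor : ∀ q y → δ 0 (∣ toℕ p - toℕ q ∣ +ℕ dist x y) *ℕ g (q ∷ y) ≡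
                     δ 0 ∣ toℕ p - toℕ q ∣ *ℕ (δ 0 (dist x y) *ℕ g (q ∷ y))
    factor q y = trans (cong (_*ℕ g (q ∷ y)) (δ-0-+ ∣ toℕ p - toℕ q ∣ (dist x y)))
                       (ℕ.*-assoc (δ 0 ∣ toℕ p - toℕ q ∣) _ _)

  -- Admissibility as a left-to-right test.

  -- In `allowed`, `adm` and `After`, the Boolean c tells whether the letter
  -- preceding the word is 0.
  allowed : Bool → ℕ → Bool
  allowed c p = c ∨ (p <ᵇ a)

  isZero : ℕ → Bool
  isZero p = p ≡ᵇ 0

  adm : ∀ {n} → Bool → W n → Bool
  adm c []      = true
  adm c (p ∷ w) = allowed c (toℕ p) ∧ adm (isZero (toℕ p)) w

  After : ∀ {n} → Bool → W n → Set
  After {n} c w = ∀ (i : Fin n) → a ≤ toℕ (lookup w i) →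
    (toℕ i ≡ 0 × T c) ⊎ ∃[ j ] (suc (toℕ j) ≡ toℕ i × toℕ (lookup w j) ≡ 0)

  -- Passing to the tail shifts positions by one. A predecessor at position 0 of the whole word
  -- drops out of the tail, and the flag `isZero (toℕ p)` remembers whether it was 0.
  After⇒adm : ∀ {n} c (w : W n) → After c w → T (adm c w)
  After⇒adm c []      _ = _
  After⇒adm c (p ∷ w) h =
    Equivalence.from T-∧ (Equivalence.from T-∨ first , After⇒adm (isZero (toℕ p)) w rest)
    where
    first : T c ⊎ T (toℕ p <ᵇ a)
    first with ℕ.<-≤-connex (toℕ p) a
    ... | inj₁ p<a = inj₂ (ℕ.<⇒<ᵇ p<a)
    ... | inj₂ a≤p with h fzero a≤p
    ...   | inj₁ (_ , t)      = inj₁ t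
    ...   | inj₂ (_ , () , _)

    rest : After (isZero (toℕ p)) w
    rest i a≤ with h (fsuc i) a≤
    ... | inj₁ (() , _)
    ... | inj₂ (fzero  , eq , z) = inj₁ (sym (ℕ.suc-injective eq) , ℕ.≡⇒≡ᵇ _ _ z)
    ... | inj₂ (fsuc j , eq , z) = inj₂ (j , ℕ.suc-injective eq , z)

  adm⇒After : ∀ {n} c (w : W n) → T (adm c w) → After c w
  adm⇒After c (p ∷ w) t i a≤ with Equivalence.to (T-∧ {allowed c (toℕ p)}) t
  adm⇒After c (p ∷ w) t fzero a≤ | ok , _ with Equivalence.to (T-∨ {c}) ok
  ... | inj₁ tc  = inj₁ (refl , tc)
  ... | inj₂ p<a = contradiction a≤ (ℕ.<⇒≱ (ℕ.<ᵇ⇒< _ _ p<a))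
  adm⇒After c (p ∷ w) t (fsuc i) a≤ | _ , rest
    with adm⇒After (isZero (toℕ p)) w rest i a≤
  ... | inj₁ (i≡0 , tz)   = inj₂ (fzero , cong suc (sym i≡0) , ℕ.≡ᵇ⇒≡ _ _ tz)
  ... | inj₂ (j , eq , z) = inj₂ (fsuc j , cong suc eq , z)

  -- Nothing precedes the first letter of a whole word, so the flag starts as `false` and the extra
  -- alternative in `After` is empty.
  Admissible⇔adm : ∀ {n} (w : W n) → Admissible a b n w ⇔ T (adm false w)
  Admissible⇔adm {n} w = mk⇔
    (λ h → After⇒adm false w λ i a≤ → inj₂ (h i a≤))
    (λ t i a≤ → drop (adm⇒After false w t i a≤))
    where
    drop : ∀ {i : Fin n} {P : Set} → (toℕ i ≡ 0 × T false) ⊎ P → P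
    drop (inj₂ p) = p

  does-admissible : ∀ {n} (w : W n) → does (admissible? a b n w) ≡ adm false w
  does-admissible {n} w = does-⇔ (Admissible⇔adm w) (admissible? a b n w) (T? (adm false w))

  -- Splitting the counts by first letters.

  weight : ∀ {n} → Bool → W n → ℕ
  weight c w = ind (adm c w)

  ok : Bool → Fin (a +ℕ b) → ℕ
  ok c p = ind (allowed c (toℕ p))

  z : Fin (a +ℕ b) → Bool
  z = isZero ∘ toℕ

  weight-∷ : ∀ {n} c p (w : W n) → weight c (p ∷ w) ≡ ok c p *ℕ weight (z p) w
  weight-∷ c p w = ind-∧ (allowed c (toℕ p)) (adm (z p) w)

  -- A preceding 0 only relaxes the condition on the first letter, so the words admissible without
  -- it are among those admissible with it.
  weight-true-false : ∀ {n} (w : W n) → weight true w *ℕ weight false w ≡ weight false w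
  weight-true-false []      = refl
  weight-true-false (p ∷ w) = lemma (toℕ p <ᵇ a) (adm (z p) w)
    where
    lemma : ∀ x y → ind y *ℕ ind (x ∧ y) ≡ ind (x ∧ y)
    lemma true  y = ind-idem y
    lemma false y = ℕ.*-zeroʳ (ind y)

  -- One less than the number of letters that may come first.
  bound : Bool → ℕ
  bound false = a′
  bound true  = a′ +ℕ b

  total-ok : ∀ c (g : ℕ → ℕ) →
    total letters (λ p → ok c p *ℕ g (toℕ p)) ≡ below (suc (bound c)) g
  total-ok false g = below-restrict a b g
  total-ok true  g = total-cong letters λ p → ℕ.*-identityˡ (g (toℕ p))

  N : Bool → ℕ → ℕ
  N c n = total (ws n) (weight c)

  -- Ordered pairs of adjacent words, hence twice the number of edges.
  E : Bool → ℕ → ℕ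
  E c n = total (ws n) λ x → total (ws n) λ y → weight c x *ℕ weight c y *ℕ δ 1 (dist x y)

  below-isZero : ∀ m (g : Bool → ℕ) → below (suc m) (g ∘ isZero) ≡ g true +ℕ m *ℕ g false
  below-isZero m g = trans (below-suc m (g ∘ isZero)) (cong (g true +ℕ_) (below-const m (g false)))

  -- A first letter 0 is always permitted and leaves a tail preceded by 0; each of the other
  -- `bound c` permitted letters leaves a tail preceded by a nonzero letter.
  N-suc : ∀ c n → N c (suc n) ≡ N true n +ℕ bound c *ℕ N false n
  N-suc c n = begin
    N c (suc n)
      ≡⟨ total-words n (weight c) ⟩
    total letters (λ p → total (ws n) λ w → weight c (p ∷ w))
      ≡⟨ total-cong letters (λ p → total-cong (ws n) (weight-∷ c p)) ⟩
    total letters (λ p → total (ws n) λ w → ok c p *ℕ weight (z p) w)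
      ≡⟨ total-product letters (ws n) (ok c) (λ p → weight (z p)) ⟩
    total letters (λ p → ok c p *ℕ N (z p) n)
      ≡⟨ total-ok c (λ p → N (isZero p) n) ⟩
    below (suc (bound c)) (λ p → N (isZero p) n)
      ≡⟨ below-isZero (bound c) (λ d → N d n) ⟩
    N true n +ℕ bound c *ℕ N false n ∎

  shared : ℕ → Bool → Bool → ℕ
  shared n c d = total (ws n) λ x → weight c x *ℕ weight d x

  -- Two consecutive letters are not both 0, so the tails they share are
  -- those admissible after a nonzero letter.
  shared-adjacent : ∀ n p q →
    δ 1 ∣ p - q ∣ *ℕ shared n (isZero p) (isZero q) ≡ δ 1 ∣ p - q ∣ *ℕ N false n
  shared-adjacent n zero    zero    = refl
  shared-adjacent n zero    (suc q) =
    cong (δ 1 (suc q) *ℕ_) (total-cong (ws n) weight-true-false)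
  shared-adjacent n (suc p) zero    = cong (δ 1 (suc p) *ℕ_) (total-cong (ws n) λ x →
    trans (ℕ.*-comm (weight false x) _) (weight-true-false x))
  shared-adjacent n (suc p) (suc q) =
    cong (δ 1 ∣ p - q ∣ *ℕ_) (total-cong (ws n) λ x → ind-idem (adm false x))

  -- Equal first letters leave an adjacent pair of tails, which gives the bracket just as in
  -- `N-suc`. Otherwise the first letters are consecutive and the tails coincide: there are
  -- `2 * bound c` ordered choices of letters, each with `N false n` tails.
  E-suc : ∀ c n → E c (suc n) ≡
    (E true n +ℕ bound c *ℕ E false n) +ℕ 2 *ℕ bound c *ℕ N false n
  E-suc c n = begin
    E c (suc n)
      ≡⟨ total-words n _ ⟩
    total letters (λ p → total (ws n) λ x → total (ws (suc n)) λ y → F (p ∷ x) y)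
      ≡⟨ total-cong letters (λ p → total-cong (ws n) λ x → total-words n (F (p ∷ x))) ⟩
    total letters (λ p → total (ws n) λ x → total letters λ q → total (ws n) λ y → F (p ∷ x) (q ∷ y))
      ≡⟨ total-cong letters (λ p → total-comm (ws n) letters _) ⟩
    total letters (λ p → total letters λ q → total (ws n) λ x → total (ws n) λ y → F (p ∷ x) (q ∷ y))
      ≡⟨ total-cong letters (λ p → total-cong letters (split p)) ⟩
    total letters (λ p → total letters λ q → same p q +ℕ next p q)
      ≡⟨ total-cong letters (λ p → total-+ letters (same p) (next p)) ⟩
    total letters (λ p → total letters (same p) +ℕ total letters (next p))
      ≡⟨ total-+ letters (λ p → total letters (same p)) (λ p → total letters (next p)) ⟩
    total letters (λ p → total letters (same p)) +ℕ total letters (λ p → total letters (next p))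
      ≡⟨ cong₂ _+ℕ_ same-total next-total ⟩
    (E true n +ℕ bound c *ℕ E false n) +ℕ 2 *ℕ bound c *ℕ N false n ∎
    where
    F : W (suc n) → W (suc n) → ℕ
    F x y = weight c x *ℕ weight c y *ℕ δ 1 (dist x y)

    G : Fin (a +ℕ b) → Fin (a +ℕ b) → ℕ
    G p q = total (ws n) λ x → total (ws n) λ y → weight (z p) x *ℕ weight (z q) y *ℕ δ 1 (dist x y)

    -- `same` collects the pairs with equal first letters and adjacent tails, `next` those with
    -- consecutive first letters and a common tail.
    same next : Fin (a +ℕ b) → Fin (a +ℕ b) → ℕ
    same p q = δ 0 ∣ toℕ p - toℕ q ∣ *ℕ (ok c p *ℕ ok c q *ℕ G p q)
    next p q = ok c p *ℕ (ok c q *ℕ (δ 1 ∣ toℕ p - toℕ q ∣ *ℕ N false n))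

    split : ∀ p q → total (ws n) (λ x → total (ws n) λ y → F (p ∷ x) (q ∷ y)) ≡ same p q +ℕ next p q
    split p q = begin
      total (ws n) (λ x → total (ws n) λ y → F (p ∷ x) (q ∷ y))
        ≡⟨ total-cong (ws n) (λ x → total-cong (ws n) (pointwise x)) ⟩
      total (ws n) (λ x → total (ws n) λ y → k₀ *ℕ g x y +ℕ k₁ *ℕ h x y)
        ≡⟨ total-cong (ws n) (λ x → trans (total-+ (ws n) (λ y → k₀ *ℕ g x y) (λ y → k₁ *ℕ h x y))
             (cong₂ _+ℕ_ (total-*ˡ (ws n) k₀ (g x)) (total-*ˡ (ws n) k₁ (h x)))) ⟩
      total (ws n) (λ x → k₀ *ℕ total (ws n) (g x) +ℕ k₁ *ℕ total (ws n) (h x))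
        ≡⟨ trans (total-+ (ws n) (λ x → k₀ *ℕ total (ws n) (g x)) (λ x → k₁ *ℕ total (ws n) (h x)))
             (cong₂ _+ℕ_ (total-*ˡ (ws n) k₀ (λ x → total (ws n) (g x)))
                         (total-*ˡ (ws n) k₁ (λ x → total (ws n) (h x)))) ⟩
      k₀ *ℕ G p q +ℕ k₁ *ℕ total (ws n) (λ x → total (ws n) (h x))
        -- In the second summand the tails are equal, so the sum over `y` collapses to `y = x` and
        -- leaves `shared`.
        ≡⟨ cong₂ _+ℕ_ (ℕ.*-assoc d₀ (ok c p *ℕ ok c q) (G p q))
             (cong (k₁ *ℕ_) (total-cong (ws n) λ x →
               total-δ-word x (λ y → weight (z p) x *ℕ weight (z q) y))) ⟩
      same p q +ℕ k₁ *ℕ shared n (z p) (z q)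
        ≡⟨ cong (same p q +ℕ_) next-eq ⟩
      same p q +ℕ next p q ∎
      where
      d₀ = δ 0 ∣ toℕ p - toℕ q ∣
      d₁ = δ 1 ∣ toℕ p - toℕ q ∣
      k₀ = d₀ *ℕ (ok c p *ℕ ok c q)
      k₁ = ok c p *ℕ ok c q *ℕ d₁

      g h : W n → W n → ℕ
      g x y = weight (z p) x *ℕ weight (z q) y *ℕ δ 1 (dist x y)
      h x y = δ 0 (dist x y) *ℕ (weight (z p) x *ℕ weight (z q) y)

      pointwise : ∀ x y → F (p ∷ x) (q ∷ y) ≡ k₀ *ℕ g x y +ℕ k₁ *ℕ h x y
      pointwise x y
        rewrite weight-∷ c p x | weight-∷ c q y | δ-1-+ ∣ toℕ p - toℕ q ∣ (dist x y) =
        arith (ok c p) (ok c q) (weight (z p) x) (weight (z q) y) d₀ d₁ (δ 0 (dist x y)) (δ 1 (dist x y))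
        where
        arith : ∀ o o′ w w′ d₀ d₁ e₀ e₁ →
          (o *ℕ w) *ℕ (o′ *ℕ w′) *ℕ (d₀ *ℕ e₁ +ℕ d₁ *ℕ e₀) ≡
          d₀ *ℕ (o *ℕ o′) *ℕ (w *ℕ w′ *ℕ e₁) +ℕ o *ℕ o′ *ℕ d₁ *ℕ (e₀ *ℕ (w *ℕ w′))
        arith = solve-∀

      next-eq : k₁ *ℕ shared n (z p) (z q) ≡ next p q
      next-eq = begin
        k₁ *ℕ shared n (z p) (z q)                           ≡⟨ ℕ.*-assoc (ok c p *ℕ ok c q) d₁ _ ⟩
        ok c p *ℕ ok c q *ℕ (d₁ *ℕ shared n (z p) (z q))
          ≡⟨ cong (ok c p *ℕ ok c q *ℕ_) (shared-adjacent n (toℕ p) (toℕ q)) ⟩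
        ok c p *ℕ ok c q *ℕ (d₁ *ℕ N false n)                ≡⟨ ℕ.*-assoc (ok c p) (ok c q) _ ⟩
        next p q ∎

    same-total : total letters (λ p → total letters (same p)) ≡ E true n +ℕ bound c *ℕ E false n
    same-total = begin
      total letters (λ p → total letters (same p))
        -- Only `q = p` survives, and the diagonal value `G p p` is `E (z p) n` by definition.
        ≡⟨ total-cong letters (λ p → total-δ-letter p (λ q → ok c p *ℕ ok c q *ℕ G p q)) ⟩
      total letters (λ p → ok c p *ℕ ok c p *ℕ E (z p) n)
        ≡⟨ total-cong letters (λ p → cong (_*ℕ E (z p) n) (ind-idem (allowed c (toℕ p)))) ⟩
      total letters (λ p → ok c p *ℕ E (z p) n)
        ≡⟨ total-ok c (λ p → E (isZero p) n) ⟩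
      below (suc (bound c)) (λ p → E (isZero p) n)
        ≡⟨ below-isZero (bound c) (λ d → E d n) ⟩
      E true n +ℕ bound c *ℕ E false n ∎

    next-total : total letters (λ p → total letters (next p)) ≡ 2 *ℕ bound c *ℕ N false n
    next-total = begin
      total letters (λ p → total letters (next p))
        ≡⟨ total-product letters letters (ok c) _ ⟩
      total letters (λ p → ok c p *ℕ total letters λ q → ok c q *ℕ (δ 1 ∣ toℕ p - toℕ q ∣ *ℕ N false n))
        ≡⟨ total-cong letters (λ p → cong (ok c p *ℕ_)
             (total-ok c λ q → δ 1 ∣ toℕ p - q ∣ *ℕ N false n)) ⟩
      total letters (λ p → ok c p *ℕ below M λ q → δ 1 ∣ toℕ p - q ∣ *ℕ N false n)
        ≡⟨ total-ok c (λ p → below M λ q → δ 1 ∣ p - q ∣ *ℕ N false n) ⟩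
      below M (λ p → below M λ q → δ 1 ∣ p - q ∣ *ℕ N false n)
        ≡⟨ total-cong (allFin M) (λ p → trans
             (total-cong (allFin M) λ q → ℕ.*-comm (δ 1 ∣ toℕ p - toℕ q ∣) (N false n))
             (total-*ˡ (allFin M) (N false n) (λ q → δ 1 ∣ toℕ p - toℕ q ∣))) ⟩
      below M (λ p → N false n *ℕ below M λ q → δ 1 ∣ p - q ∣)
        ≡⟨ total-*ˡ (allFin M) (N false n) (λ p → below M λ q → δ 1 ∣ toℕ p - q ∣) ⟩
      N false n *ℕ below M (λ p → below M λ q → δ 1 ∣ p - q ∣)
        ≡⟨ cong (N false n *ℕ_) (below-adjacent (bound c)) ⟩
      N false n *ℕ (2 *ℕ bound c)
        ≡⟨ ℕ.*-comm (N false n) (2 *ℕ bound c) ⟩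
      2 *ℕ bound c *ℕ N false n ∎
      where M = suc (bound c)

  -- Recurrences for the order and the size.

  s≡N : ∀ n → s a b n ≡ N false n
  s≡N n = trans (length-filter (admissible? a b n) (ws n))
                (total-cong (ws n) λ w → cong ind (does-admissible w))

  -- Adjacency is symmetric and irreflexive, so `total-pairs` turns listed pairs into ordered ones;
  -- the weights then extend the sums from admissible words to all words.
  2*size≡E : ∀ n → 2 *ℕ size (Π a b n) ≡ E false n
  2*size≡E n = begin
    2 *ℕ size (Π a b n)
      ≡⟨ cong (2 *ℕ_) (length-filter _ (pairs (𝒮 a b n))) ⟩
    2 *ℕ total (pairs (𝒮 a b n)) (λ e → adj (proj₁ e) (proj₂ e))
      ≡⟨ total-pairs adj (λ x y → cong (δ 1) (dist-comm x y)) (λ x → cong (δ 1) (dist-self x)) (𝒮 a b n) ⟩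
    total (𝒮 a b n) (λ x → total (𝒮 a b n) (adj x))
      ≡⟨ total-𝒮 (λ x → total (𝒮 a b n) (adj x)) ⟩
    total (ws n) (λ x → weight false x *ℕ total (𝒮 a b n) (adj x))
      ≡⟨ total-cong (ws n) (λ x → trans (cong (weight false x *ℕ_) (total-𝒮 (adj x)))
           (sym (total-*ˡ (ws n) (weight false x) _))) ⟩
    total (ws n) (λ x → total (ws n) λ y → weight false x *ℕ (weight false y *ℕ adj x y))
      ≡⟨ total-cong (ws n) (λ x → total-cong (ws n) λ y → ℕ.*-assoc (weight false x) _ _) ⟨
    E false n ∎
    where
    adj : W n → W n → ℕ
    adj x y = δ 1 (dist x y)

    total-𝒮 : ∀ f → total (𝒮 a b n) f ≡ total (ws n) (λ x → weight false x *ℕ f x)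
    total-𝒮 f = trans (total-filter (admissible? a b n) (ws n) f)
      (total-cong (ws n) λ x → cong (λ u → ind u *ℕ f x) (does-admissible x))

  -- `N-suc` expresses all three values through `N true n` and `N false n`, and what remains is a
  -- polynomial identity.
  s-rec : ∀ n → s a b (2 +ℕ n) ≡ a *ℕ s a b (1 +ℕ n) +ℕ b *ℕ s a b n
  s-rec n rewrite s≡N (2 +ℕ n) | s≡N (1 +ℕ n) | s≡N n
                | N-suc false (suc n) | N-suc true n | N-suc false n =
    arith (N true n) (N false n) a′ b
    where
    arith : ∀ t f a b → t +ℕ (a +ℕ b) *ℕ f +ℕ a *ℕ (t +ℕ a *ℕ f) ≡
                        (1 +ℕ a) *ℕ (t +ℕ a *ℕ f) +ℕ b *ℕ f
    arith = solve-∀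

  s₁ : s a b 1 ≡ a
  s₁ rewrite s≡N 1 | N-suc false 0 = cong suc (ℕ.*-identityʳ a′)

  size-rec : ∀ n → size (Π a b (2 +ℕ n)) ≡
    a *ℕ size (Π a b (1 +ℕ n)) +ℕ b *ℕ (size (Π a b n) +ℕ s a b n) +ℕ a′ *ℕ s a b (1 +ℕ n)
  size-rec n = ℕ.*-cancelˡ-≡ _ _ 2 (begin
    2 *ℕ e₂
      ≡⟨ 2*size≡E (2 +ℕ n) ⟩
    E false (2 +ℕ n)
      ≡⟨ E-suc false (suc n) ⟩
    E true (suc n) +ℕ a′ *ℕ E false (suc n) +ℕ 2 *ℕ a′ *ℕ N false (suc n)
      ≡⟨ cong (λ u → u +ℕ a′ *ℕ E false (suc n) +ℕ 2 *ℕ a′ *ℕ N false (suc n)) E-true ⟩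
    E false (suc n) +ℕ b *ℕ (E false n +ℕ 2 *ℕ N false n) +ℕ a′ *ℕ E false (suc n)
      +ℕ 2 *ℕ a′ *ℕ N false (suc n)
      ≡⟨ unfold ⟩
    2 *ℕ e₁ +ℕ b *ℕ (2 *ℕ e₀ +ℕ 2 *ℕ s₀) +ℕ a′ *ℕ (2 *ℕ e₁) +ℕ 2 *ℕ a′ *ℕ s₁′
      ≡⟨ arith e₁ e₀ s₀ s₁′ a′ b ⟩
    2 *ℕ (a *ℕ e₁ +ℕ b *ℕ (e₀ +ℕ s₀) +ℕ a′ *ℕ s₁′) ∎)
    where
    e₀ = size (Π a b n)
    e₁ = size (Π a b (1 +ℕ n))
    e₂ = size (Π a b (2 +ℕ n))
    s₀ = s a b n
    s₁′ = s a b (1 +ℕ n)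

    -- The two cases of `E-suc` differ only in `bound`, by `b`. This eliminates the count for words
    -- preceded by 0.
    E-true : E true (suc n) ≡ E false (suc n) +ℕ b *ℕ (E false n +ℕ 2 *ℕ N false n)
    E-true rewrite E-suc true n | E-suc false n = lemma (E true n) (E false n) (N false n) a′ b
      where
      lemma : ∀ t f m a b → t +ℕ (a +ℕ b) *ℕ f +ℕ 2 *ℕ (a +ℕ b) *ℕ m ≡
                            t +ℕ a *ℕ f +ℕ 2 *ℕ a *ℕ m +ℕ b *ℕ (f +ℕ 2 *ℕ m)
      lemma = solve-∀

    unfold : E false (suc n) +ℕ b *ℕ (E false n +ℕ 2 *ℕ N false n) +ℕ a′ *ℕ E false (suc n)
        +ℕ 2 *ℕ a′ *ℕ N false (suc n) ≡
      2 *ℕ e₁ +ℕ b *ℕ (2 *ℕ e₀ +ℕ 2 *ℕ s₀) +ℕ a′ *ℕ (2 *ℕ e₁) +ℕ 2 *ℕ a′ *ℕ s₁′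
    unfold rewrite 2*size≡E (1 +ℕ n) | 2*size≡E n | s≡N n | s≡N (1 +ℕ n) = refl

    arith : ∀ e₁ e₀ s₀ s₁ a b →
      2 *ℕ e₁ +ℕ b *ℕ (2 *ℕ e₀ +ℕ 2 *ℕ s₀) +ℕ a *ℕ (2 *ℕ e₁) +ℕ 2 *ℕ a *ℕ s₁ ≡
      2 *ℕ ((1 +ℕ a) *ℕ e₁ +ℕ b *ℕ (e₀ +ℕ s₀) +ℕ a *ℕ s₁)
    arith = solve-∀

  size₀ : size (Π a b 0) ≡ 0
  size₀ = ℕ.*-cancelˡ-≡ _ _ 2 (2*size≡E 0)

  size₁ : size (Π a b 1) ≡ a′
  size₁ = ℕ.*-cancelˡ-≡ _ _ 2 (trans (2*size≡E 1) (trans (E-suc false 0) (arith a′)))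
    where
    arith : ∀ a → 0 +ℕ a *ℕ 0 +ℕ 2 *ℕ a *ℕ 1 ≡ 2 *ℕ a
    arith = solve-∀

-- The convolution and its recurrence.

conv : (ℕ → ℤ) → (ℕ → ℤ) → ℕ → ℤ
-- Here `k < n`, so both truncated subtractions are exact.
conv t g n = ∑[ k < n ] (g (toℕ k) * (t (n ∸ toℕ k) - t (n ∸ 1 ∸ toℕ k)))

-- Generalising the left factor lets the induction peel off the term k = 0.
conv-rec : ∀ (t : ℕ → ℤ) (a b : ℤ) → t 0 ≡ + 1 → t 1 ≡ a →
  (∀ n → t (2 +ℕ n) ≡ a * t (1 +ℕ n) +ℤ b * t n) → ∀ g n →
  conv t g (2 +ℕ n) ≡
    a * conv t g (1 +ℕ n) +ℤ b * (conv t g n +ℤ g n) +ℤ (a - + 1) * g (1 +ℕ n)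
-- The inhomogeneous terms come from the last two indices: `t 1 - t 0` is a - 1, and `t 2 - t 1` is
-- a (a - 1) + b, which exceeds a times the former by b.
conv-rec t a b t₀ t₁ t-rec g zero rewrite t-rec 0 | t₀ | t₁ = arith a b (g 0) (g 1)
  where
  arith : ∀ a b g₀ g₁ →
    g₀ * ((a * a +ℤ b * + 1) - a) +ℤ (g₁ * (a - + 1) +ℤ + 0) ≡
    a * (g₀ * (a - + 1) +ℤ + 0) +ℤ b * (+ 0 +ℤ g₀) +ℤ (a - + 1) * g₁
  arith = solve-∀ℤ
conv-rec t a b t₀ t₁ t-rec g (suc n) = begin
  g 0 * (t (3 +ℕ n) - t (2 +ℕ n)) +ℤ conv t g⁺ (2 +ℕ n)
    -- The term `k = 0` obeys the homogeneous recurrence, because differences of `t` do; the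
    -- inhomogeneous terms are supplied by the induction hypothesis for `g⁺`.
    ≡⟨ cong₂ (λ u v → g 0 * u +ℤ v) (cong₂ _-_ (t-rec (suc n)) (t-rec n))
         (conv-rec t a b t₀ t₁ t-rec g⁺ n) ⟩
  g 0 * ((a * t (2 +ℕ n) +ℤ b * t (1 +ℕ n)) - (a * t (1 +ℕ n) +ℤ b * t n))
    +ℤ (a * conv t g⁺ (1 +ℕ n) +ℤ b * (conv t g⁺ n +ℤ g (1 +ℕ n)) +ℤ (a - + 1) * g (2 +ℕ n))
    ≡⟨ arith a b (g 0) (t (2 +ℕ n)) (t (1 +ℕ n)) (t n) (conv t g⁺ (1 +ℕ n)) (conv t g⁺ n) _ _ ⟩
  a * (g 0 * (t (2 +ℕ n) - t (1 +ℕ n)) +ℤ conv t g⁺ (1 +ℕ n))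
    +ℤ b * ((g 0 * (t (1 +ℕ n) - t n) +ℤ conv t g⁺ n) +ℤ g (1 +ℕ n)) +ℤ (a - + 1) * g (2 +ℕ n)
    ≡⟨ cong (λ u → a * (g 0 * (t (2 +ℕ n) - t (1 +ℕ n)) +ℤ conv t g⁺ (1 +ℕ n))
         +ℤ b * (u +ℤ g (1 +ℕ n)) +ℤ (a - + 1) * g (2 +ℕ n)) (conv-suc n) ⟨
  a * conv t g (2 +ℕ n) +ℤ b * (conv t g (1 +ℕ n) +ℤ g (1 +ℕ n)) +ℤ (a - + 1) * g (2 +ℕ n) ∎
  where
  g⁺ = g ∘ suc

  -- `m ∸ suc k` and `m ∸ 1 ∸ k` agree by computation only when `m` is a successor; for `m = 0` the
  -- remaining sum is empty.
  conv-suc : ∀ m → conv t g (suc m) ≡ g 0 * (t (suc m) - t m) +ℤ conv t g⁺ m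
  conv-suc zero    = refl
  conv-suc (suc m) = refl

  arith : ∀ a b g₀ t₂ t₁ t₀ c₁ c₀ g₁ g₂ →
    g₀ * ((a * t₂ +ℤ b * t₁) - (a * t₁ +ℤ b * t₀))
      +ℤ (a * c₁ +ℤ b * (c₀ +ℤ g₁) +ℤ (a - + 1) * g₂) ≡
    a * (g₀ * (t₂ - t₁) +ℤ c₁)
      +ℤ b * ((g₀ * (t₁ - t₀) +ℤ c₀) +ℤ g₁) +ℤ (a - + 1) * g₂
  arith = solve-∀ℤ

-- Identifying the size with the convolution over the integers.

module _ (a′ b : ℕ) where
  open Count a′ b

  sℤ : ℕ → ℤ
  sℤ n = + s a b n

  sℤ-rec : ∀ n → sℤ (2 +ℕ n) ≡ + a * sℤ (1 +ℕ n) +ℤ + b * sℤ n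
  sℤ-rec n = trans (cong +_ (s-rec n))
    (cong₂ _+ℤ_ (ℤ.pos-* a (s a b (1 +ℕ n))) (ℤ.pos-* b (s a b n)))

  -- The last coefficient is written `+ a - + 1` to match `conv-rec`; it reduces to `+ a′`.
  sizeℤ-rec : ∀ n → + size (Π a b (2 +ℕ n)) ≡
    + a * + size (Π a b (1 +ℕ n)) +ℤ + b * (+ size (Π a b n) +ℤ sℤ n) +ℤ (+ a - + 1) * sℤ (1 +ℕ n)
  sizeℤ-rec n = trans (cong +_ (size-rec n))
    (cong₂ _+ℤ_ (cong₂ _+ℤ_ (ℤ.pos-* a (size (Π a b (1 +ℕ n)))) (ℤ.pos-* b (size (Π a b n) +ℕ s a b n)))
                (ℤ.pos-* a′ (s a b (1 +ℕ n))))

  -- Both sides satisfy the same second-order recurrence, so the induction carries two consecutive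
  -- values.
  size≡conv : ∀ n → + size (Π a b n) ≡ conv sℤ sℤ n × + size (Π a b (1 +ℕ n)) ≡ conv sℤ sℤ (1 +ℕ n)
  size≡conv zero    = cong +_ size₀ , (begin
    + size (Π a b 1)                      ≡⟨ cong +_ size₁ ⟩
    + a - + 1                             ≡⟨ arith (+ a) ⟩
    + 1 * (+ a - + 1) +ℤ + 0              ≡⟨ cong (λ u → + 1 * (+ u - + 1) +ℤ + 0) s₁ ⟨
    conv sℤ sℤ 1 ∎)
    where
    arith : ∀ a → a - + 1 ≡ + 1 * (a - + 1) +ℤ + 0
    arith = solve-∀ℤ
  size≡conv (suc n) with e₀ , e₁ ← size≡conv n = e₁ , (begin
    + size (Π a b (2 +ℕ n))
      ≡⟨ sizeℤ-rec n ⟩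
    + a * + size (Π a b (1 +ℕ n)) +ℤ + b * (+ size (Π a b n) +ℤ sℤ n) +ℤ (+ a - + 1) * sℤ (1 +ℕ n)
      ≡⟨ cong₂ (λ u v → + a * u +ℤ + b * (v +ℤ sℤ n) +ℤ (+ a - + 1) * sℤ (1 +ℕ n)) e₁ e₀ ⟩
    + a * conv sℤ sℤ (1 +ℕ n) +ℤ + b * (conv sℤ sℤ n +ℤ sℤ n) +ℤ (+ a - + 1) * sℤ (1 +ℕ n)
      ≡⟨ conv-rec sℤ (+ a) (+ b) refl (cong +_ s₁) sℤ-rec sℤ n ⟨
    conv sℤ sℤ (2 +ℕ n) ∎)

theorem4 : ∀ (a b n : ℕ) → 1 ≤ a → 1 ≤ b →
    + size (Π a b n) ≡
    ∑[ k < n ] (+ s a b (toℕ k) * (+ s a b (n ∸ toℕ k) - + s a b (n ∸ 1 ∸ toℕ k)))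
theorem4 (suc a′) b n _ _ = proj₁ (size≡conv a′ b n)
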